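{- Let $\mathcal L$ be a summable category, with summability structure $(\mathbf S,\pi_0,\pi_1,\sigma)$. Then $\mathcal L$ is enriched in partial commutative monoids by the partial addition operation induced by the summability structure: each hom-set $\mathcal L(X,Y)$, equipped with the zero morphism $0_{X,Y}$ and the partial operation $(f_0,f_1)\mapsto f_0+f_1$ (defined exactly when $f_0,f_1$ are summable), is a partial commutative monoid, and composition is compatible with this structure.
   Context: A partial commutative monoid is a triple $(M,0,+)$ where $M$ is a set, $0\in M$ and $+:M^2\to M$ is a partial function such that: $0+a$ is defined and equals $a$ for all $a\in M$; if $a+b$ is defined then $b+a$ is defined and $a+b=b+a$; if $a+b$ and $(a+b)+c$ are defined then $b+c$ and $a+(b+c)$ are defined and $(a+b)+c=a+(b+c)$. A category $\mathcal L$ has zero-morphisms if each hom-set $\mathcal L(X,Y)$ has a distinguished element $0=0_{X,Y}$ with $f\,0=0$ and $0\,f=0$ for all composable $f$. A pre-summability structure on such an $\mathcal L$ is a tuple $(\mathbf S,\pi_0,\pi_1,\sigma)$ where $\mathbf S:\mathcal L\to\mathcal L$ is a functor and $\pi_0,\pi_1,\sigma$ are natural transformations with components in $\mathcal L(\mathbf SX,X)$ such that $\pi_0,\pi_1$ are jointly monic (if $\pi_i f=\pi_i g$ for $i=0,1$ then $f=g$). Morphisms $f_0,f_1\in\mathcal L(Y,X)$ are summable if there is $h\in\mathcal L(Y,\mathbf SX)$ with $\pi_ih=f_i$ for $i=0,1$; this $h$ is unique, it is written $\langle\!\langle f_0,f_1\rangle\!\rangle$ (the witness), and $f_0+f_1:=\sigma\,\langle\!\langle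 f_0,f_1\rangle\!\rangle$. A summability structure is a pre-summability structure such that: ($\mathbf S$-com) $\pi_1$ and $\pi_0$ are summable (in this order) with $\pi_1+\pi_0=\sigma$; ($\mathbf S$-zero) $0_{X,X}$ and $\mathrm{Id}_X$ are summable with $0+\mathrm{Id}_X=\mathrm{Id}_X$; ($\mathbf S$-wit) for any $f_0,f_1\in\mathcal L(X,\mathbf SY)$, if $\sigma f_0$ and $\sigma f_1$ are summable then $f_0$ and $f_1$ are summable. A summable category is a category with zero-morphisms equipped with a summability structure. Compatibility of composition means: $h\,0\,g=0$, and if $f_0,f_1\in\mathcal L(X,Y)$ are summable, $g\in\mathcal L(U,X)$, $h\in\mathcal L(Y,V)$, then $hf_0g$ and $hf_1g$ are summable and $hf_0g+hf_1g=h(f_0+f_1)g$. -}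

module Defs where

open import Level using (Level; suc; _⊔_)
open import Data.Product using (Σ-syntax)
open import Relation.Binary.Core using (Rel)
open import Relation.Binary.Bundles using (Setoid)
open import Relation.Binary.Structures using (IsEquivalence)

-- A partial binary operation on a setoid M consists of a relation a # b
-- ("a + b is defined") and a value  add p  for each proof  p : a # b.
-- The fields #-resp-≈ and add-cong say that this is a partial function on M: both
-- definedness and the value depend only on a and b up to ≈, and the value
-- not on p.
record IsPartialCommutativeMonoid
         {a e d : Level} (M : Setoid a e)
         (0# : Setoid.Carrier M)
         (_#_ : Rel (Setoid.Carrier M) d)
         (add : {x y : Setoid.Carrier M} → x # y → Setoid.Carrier M)
       : Set (a ⊔ e ⊔ d) where
  open Setoid M using (Carrier; _≈_)
  field
    #-resp-≈ : {x x′ y y′ : Carrier} → x ≈ x′ → y ≈ y′ → x # y → x′ # y′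
    add-cong : {x x′ y y′ : Carrier} → x ≈ x′ → y ≈ y′ →
               (p : x # y) (q : x′ # y′) → add p ≈ add q
    identityˡ : (x : Carrier) → Σ[ p ∈ 0# # x ] add p ≈ x
    comm : {x y : Carrier} (p : x # y) → Σ[ q ∈ y # x ] add p ≈ add q
    assoc : {x y z : Carrier} (p : x # y) (q : add p # z) →
            Σ[ r ∈ y # z ] Σ[ s ∈ x # add r ] add q ≈ add s

-- Hom-sets are setoids; taking _≈_ to be _≡_ gives hom-sets in the naive sense.
record Category (o ℓ e : Level) : Set (suc (o ⊔ ℓ ⊔ e)) where
  infix  4 _≈_ _⇒_
  infixr 9 _∘_
  field
    Obj : Set o
    _⇒_ : Rel Obj ℓ
    _≈_ : {X Y : Obj} → Rel (X ⇒ Y) e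
    id  : {X : Obj} → X ⇒ X
    _∘_ : {X Y Z : Obj} → Y ⇒ Z → X ⇒ Y → X ⇒ Z
    equiv     : {X Y : Obj} → IsEquivalence (_≈_ {X} {Y})
    ∘-resp-≈  : {X Y Z : Obj} {f f′ : Y ⇒ Z} {g g′ : X ⇒ Y} →
                f ≈ f′ → g ≈ g′ → f ∘ g ≈ f′ ∘ g′
    identityˡ : {X Y : Obj} {f : X ⇒ Y} → id ∘ f ≈ f
    identityʳ : {X Y : Obj} {f : X ⇒ Y} → f ∘ id ≈ f
    assoc     : {W X Y Z : Obj} {f : W ⇒ X} {g : X ⇒ Y} {h : Y ⇒ Z} →
                (h ∘ g) ∘ f ≈ h ∘ (g ∘ f)

  hom : Obj → Obj → Setoid ℓ e
  hom X Y = record { Carrier = X ⇒ Y ; _≈_ = _≈_ ; isEquivalence = equiv }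

record Endofunctor {o ℓ e : Level} (C : Category o ℓ e) : Set (o ⊔ ℓ ⊔ e) where
  open Category C
  field
    F₀ : Obj → Obj
    F₁ : {X Y : Obj} → X ⇒ Y → F₀ X ⇒ F₀ Y
    F-resp-≈ : {X Y : Obj} {f g : X ⇒ Y} → f ≈ g → F₁ f ≈ F₁ g
    F-id : {X : Obj} → F₁ (id {X}) ≈ id
    F-∘  : {X Y Z : Obj} {f : X ⇒ Y} {g : Y ⇒ Z} → F₁ (g ∘ f) ≈ F₁ g ∘ F₁ f

idF : {o ℓ e : Level} (C : Category o ℓ e) → Endofunctor C
idF C = record
  { F₀ = λ X → X
  ; F₁ = λ f → f
  ; F-resp-≈ = λ p → p
  ; F-id = IsEquivalence.refl equiv
  ; F-∘ = IsEquivalence.refl equiv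
  }
  where open Category C

record NaturalTransformation {o ℓ e : Level} {C : Category o ℓ e}
                             (F G : Endofunctor C) : Set (o ⊔ ℓ ⊔ e) where
  open Category C
  private
    module F = Endofunctor F
    module G = Endofunctor G
  field
    η : (X : Obj) → F.F₀ X ⇒ G.F₀ X
    commute : {X Y : Obj} (f : X ⇒ Y) → η Y ∘ F.F₁ f ≈ G.F₁ f ∘ η X

record ZeroMorphisms {o ℓ e : Level} (C : Category o ℓ e) : Set (o ⊔ ℓ ⊔ e) where
  open Category C
  field
    𝟎 : {X Y : Obj} → X ⇒ Y
    zeroʳ : {X Y Z : Obj} (f : Y ⇒ Z) → f ∘ 𝟎 {X} {Y} ≈ 𝟎
    zeroˡ : {X Y Z : Obj} (f : X ⇒ Y) → 𝟎 {Y} {Z} ∘ f ≈ 𝟎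

record PreSummabilityStructure {o ℓ e : Level} (C : Category o ℓ e)
       : Set (o ⊔ ℓ ⊔ e) where
  open Category C
  field
    S : Endofunctor C
    π₀-nat π₁-nat σ-nat : NaturalTransformation S (idF C)

  open Endofunctor S public renaming (F₀ to S₀; F₁ to S₁)

  π₀ : (X : Obj) → S₀ X ⇒ X
  π₀ = NaturalTransformation.η π₀-nat

  π₁ : (X : Obj) → S₀ X ⇒ X
  π₁ = NaturalTransformation.η π₁-nat

  σ : (X : Obj) → S₀ X ⇒ X
  σ = NaturalTransformation.η σ-nat

  field
    jointly-monic : {X Y : Obj} {f g : Y ⇒ S₀ X} →
                    π₀ X ∘ f ≈ π₀ X ∘ g → π₁ X ∘ f ≈ π₁ X ∘ g → f ≈ g

  record Summable {Y X : Obj} (f₀ f₁ : Y ⇒ X) : Set (ℓ ⊔ e) where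
    constructor summable
    field
      witness : Y ⇒ S₀ X
      π₀-witness : π₀ X ∘ witness ≈ f₀
      π₁-witness : π₁ X ∘ witness ≈ f₁

  -- sum p is f₀ + f₁, for p a proof that f₀ and f₁ are summable.
  sum : {Y X : Obj} {f₀ f₁ : Y ⇒ X} → Summable f₀ f₁ → Y ⇒ X
  sum {X = X} p = σ X ∘ Summable.witness p

record IsSummabilityStructure {o ℓ e : Level} {C : Category o ℓ e}
         (Z : ZeroMorphisms C) (P : PreSummabilityStructure C)
       : Set (o ⊔ ℓ ⊔ e) where
  open Category C
  open ZeroMorphisms Z
  open PreSummabilityStructure P
  field
    S-com  : (X : Obj) → Σ[ p ∈ Summable (π₁ X) (π₀ X) ] sum p ≈ σ X
    S-zero : (X : Obj) → Σ[ p ∈ Summable (𝟎 {X} {X}) id ] sum p ≈ id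
    S-wit  : {X Y : Obj} (f₀ f₁ : X ⇒ S₀ Y) →
             Summable (σ Y ∘ f₀) (σ Y ∘ f₁) → Summable f₀ f₁

record SummableCategory (o ℓ e : Level) : Set (suc (o ⊔ ℓ ⊔ e)) where
  field
    category : Category o ℓ e
    zeroMorphisms : ZeroMorphisms category
    preSummability : PreSummabilityStructure category
    isSummability : IsSummabilityStructure zeroMorphisms preSummability

  open Category category public
  open ZeroMorphisms zeroMorphisms public
  open PreSummabilityStructure preSummability public
    hiding (F-resp-≈; F-id; F-∘)
  open IsSummabilityStructure isSummability public

record IsPCMEnriched {o ℓ e d : Level} (C : Category o ℓ e)
         (𝟎 : {X Y : Category.Obj C} → Category._⇒_ C X Y)
         (_#_ : {X Y : Category.Obj C} → Rel (Category._⇒_ C X Y) d)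
         (add : {X Y : Category.Obj C} {f₀ f₁ : Category._⇒_ C X Y} →
                f₀ # f₁ → Category._⇒_ C X Y)
       : Set (o ⊔ ℓ ⊔ e ⊔ d) where
  open Category C
  field
    hom-isPCM : (X Y : Obj) →
                IsPartialCommutativeMonoid (hom X Y) 𝟎 _#_ add
    ∘-zero : {U X Y V : Obj} (g : U ⇒ X) (h : Y ⇒ V) →
             h ∘ 𝟎 {X} {Y} ∘ g ≈ 𝟎
    ∘-sum : {U X Y V : Obj} {f₀ f₁ : X ⇒ Y} (p : f₀ # f₁)
            (g : U ⇒ X) (h : Y ⇒ V) →
            Σ[ q ∈ (h ∘ f₀ ∘ g) # (h ∘ f₁ ∘ g) ] add q ≈ h ∘ add p ∘ g

-- Associativity: given x + y with witness h and (x + y) + z, write z = σ ⟨⟨0 , z⟩⟩. Then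
-- S-wit yields H : Y ⇒ S (S X) with π₀ H = h and π₁ H = ⟨⟨0 , z⟩⟩. By naturality
-- S π₀ H = ⟨⟨x , 0⟩⟩, S π₁ H = ⟨⟨y , z⟩⟩ and S σ H = ⟨⟨x + y , z⟩⟩, whereas
-- σ H = ⟨⟨x + 0 , y + z⟩⟩. Naturality of σ with respect to itself, σ (S σ) = σ σ,
-- then equates the two sums.
module Submission where

open import Defs
open import Level using (Level)
open import Data.Product using (Σ-syntax; _,_; proj₁; proj₂)
open import Relation.Binary.Bundles using (Setoid)
import Relation.Binary.Reasoning.Setoid as SetoidReasoning

module Summability {o ℓ e : Level} (𝓛 : SummableCategory o ℓ e) where
  open SummableCategory 𝓛
  open Summable
  private
    module Hom {X Y : Obj} = Setoid (hom X Y)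
    module ≈-Reasoning {X Y : Obj} = SetoidReasoning (hom X Y)
  open Hom using (refl; sym; trans)

  ∘-congˡ : {X Y Z : Obj} {f : Y ⇒ Z} {g g′ : X ⇒ Y} → g ≈ g′ → f ∘ g ≈ f ∘ g′
  ∘-congˡ = ∘-resp-≈ refl

  ∘-congʳ : {X Y Z : Obj} {f f′ : Y ⇒ Z} {g : X ⇒ Y} → f ≈ f′ → f ∘ g ≈ f′ ∘ g
  ∘-congʳ p = ∘-resp-≈ p refl

  pullˡ : {W X Y Z : Obj} {f : Y ⇒ Z} {g : X ⇒ Y} {k : X ⇒ Z} {w : W ⇒ X} →
          f ∘ g ≈ k → f ∘ (g ∘ w) ≈ k ∘ w
  pullˡ p = trans (sym assoc) (∘-congʳ p)

  -- Naturality of `α`, reassociated. For `π₀` and `π₁` it gives the components of `S₁ h ∘ w`; for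
  -- `σ` it gives the value of the resulting sum.
  slide : (α : NaturalTransformation S (idF category)) {W X Y : Obj}
          (h : X ⇒ Y) (w : W ⇒ S₀ X) →
          let open NaturalTransformation α in η Y ∘ (S₁ h ∘ w) ≈ h ∘ (η X ∘ w)
  slide α h w = trans (pullˡ (NaturalTransformation.commute α h)) assoc

  Summable-resp-≈ : {X Y : Obj} {f₀ f₁ g₀ g₁ : X ⇒ Y} →
                    f₀ ≈ g₀ → f₁ ≈ g₁ → Summable f₀ f₁ → Summable g₀ g₁
  Summable-resp-≈ e₀ e₁ (summable w w₀ w₁) = summable w (trans w₀ e₀) (trans w₁ e₁)

  -- By joint monicity of `π₀` and `π₁`; hence a sum depends only on its two summands.
  witness-unique : {X Y : Obj} {f₀ f₁ g₀ g₁ : X ⇒ Y} → f₀ ≈ g₀ → f₁ ≈ g₁ →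
                   (p : Summable f₀ f₁) (q : Summable g₀ g₁) → witness p ≈ witness q
  witness-unique e₀ e₁ (summable _ p₀ p₁) (summable _ q₀ q₁) =
    jointly-monic (trans p₀ (trans e₀ (sym q₀))) (trans p₁ (trans e₁ (sym q₁)))

  sum-cong : {X Y : Obj} {f₀ f₁ g₀ g₁ : X ⇒ Y} → f₀ ≈ g₀ → f₁ ≈ g₁ →
             (p : Summable f₀ f₁) (q : Summable g₀ g₁) → sum p ≈ sum q
  sum-cong e₀ e₁ p q = ∘-congˡ (witness-unique e₀ e₁ p q)

  precompose : {X Y U : Obj} {f₀ f₁ : X ⇒ Y} → Summable f₀ f₁ →
               (g : U ⇒ X) → Summable (f₀ ∘ g) (f₁ ∘ g)
  precompose (summable w w₀ w₁) g = summable (w ∘ g) (pullˡ w₀) (pullˡ w₁)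

  postcompose : {X Y V : Obj} {f₀ f₁ : X ⇒ Y} (h : Y ⇒ V) →
                Summable f₀ f₁ → Summable (h ∘ f₀) (h ∘ f₁)
  postcompose h (summable w w₀ w₁) =
    summable (S₁ h ∘ w) (trans (slide π₀-nat h w) (∘-congˡ w₀))
                        (trans (slide π₁-nat h w) (∘-congˡ w₁))

  sum-precompose : {X Y U : Obj} {f₀ f₁ : X ⇒ Y} (p : Summable f₀ f₁) (g : U ⇒ X) →
                   sum (precompose p g) ≈ sum p ∘ g
  sum-precompose p g = sym assoc

  sum-postcompose : {X Y V : Obj} {f₀ f₁ : X ⇒ Y} (h : Y ⇒ V) (p : Summable f₀ f₁) →
                    sum (postcompose h p) ≈ h ∘ sum p
  sum-postcompose h p = slide σ-nat h (witness p)

  sum-zeroˡ : {X Y : Obj} (f : X ⇒ Y) → Σ[ p ∈ Summable 𝟎 f ] sum p ≈ f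
  sum-zeroˡ {Y = Y} f with S-zero Y
  ... | p , p≈id =
    Summable-resp-≈ (zeroˡ f) identityˡ (precompose p f) ,
    trans (sum-precompose p f) (trans (∘-congʳ p≈id) identityˡ)

  -- `S-com` is the universal case: precomposing the summable pair `π₁`, `π₀` with the witness `w`
  -- gives `f₁`, `f₀`, with sum `σ Y ∘ w`.
  sum-comm : {X Y : Obj} {f₀ f₁ : X ⇒ Y} (p : Summable f₀ f₁) →
             Σ[ q ∈ Summable f₁ f₀ ] sum p ≈ sum q
  sum-comm {Y = Y} (summable w w₀ w₁) with S-com Y
  ... | c , c≈σ =
    Summable-resp-≈ w₁ w₀ (precompose c w) ,
    sym (trans (sum-precompose c w) (∘-congʳ c≈σ))

  -- Commutativity moves the zero to the left; the swapped proof is then exchanged for the one from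
  -- `sum-zeroˡ`.
  sum-zeroʳ : {X Y : Obj} {f : X ⇒ Y} (p : Summable f 𝟎) → sum p ≈ f
  sum-zeroʳ {f = f} p =
    trans (proj₂ (sum-comm p))
          (trans (sum-cong refl refl (proj₁ (sum-comm p)) (proj₁ (sum-zeroˡ f)))
                 (proj₂ (sum-zeroˡ f)))

  sum-assoc : {X Y : Obj} {x y z : Y ⇒ X} (p : Summable x y) (q : Summable (sum p) z) →
              Σ[ r ∈ Summable y z ] Σ[ s ∈ Summable x (sum r) ] sum q ≈ sum s
  sum-assoc {X} {Y} {x} {y} {z} p q = r , s , q≈s
    where
    k : Summable 𝟎 z
    k = proj₁ (sum-zeroˡ z)

    k≈z : sum k ≈ z
    k≈z = proj₂ (sum-zeroˡ z)

    H : Summable (witness p) (witness k)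
    H = S-wit (witness p) (witness k) (Summable-resp-≈ refl (sym k≈z) q)

    x+0 : Summable x 𝟎
    x+0 = Summable-resp-≈ (π₀-witness p) (π₀-witness k) (postcompose (π₀ X) H)

    r : Summable y z
    r = Summable-resp-≈ (π₁-witness p) (π₁-witness k) (postcompose (π₁ X) H)

    s : Summable x (sum r)
    -- Naturality of `σ` turns the projections of `sum H` into sums of projections: the first is x +
    -- 0, hence `x`, and the second is y + z, which is `sum r` definitionally.
    s = summable (sum H)
          (trans (sym (sum-postcompose (π₀ X) H)) (sum-zeroʳ x+0))
          (sym (sum-postcompose (π₁ X) H))

    q≈s : sum q ≈ sum s
    q≈s = begin
      sum q                     ≈⟨ sum-cong refl (sym k≈z) q (postcompose (σ X) H) ⟩
      -- The lemma ends in `σ X ∘ sum H`; this is `sum s` by definition, since `sum H` is the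
      -- witness of `s`.
      sum (postcompose (σ X) H) ≈⟨ sum-postcompose (σ X) H ⟩
      sum s                     ∎
      where open ≈-Reasoning

  hom-isPCM : (X Y : Obj) → IsPartialCommutativeMonoid (hom X Y) 𝟎 Summable sum
  hom-isPCM X Y = record
    { #-resp-≈  = Summable-resp-≈
    ; add-cong  = sum-cong
    ; identityˡ = sum-zeroˡ
    ; comm      = sum-comm
    ; assoc     = sum-assoc
    }

mainTheorem1 : {o ℓ e : Level} (𝓛 : SummableCategory o ℓ e) →
    let open SummableCategory 𝓛 in
    IsPCMEnriched category 𝟎 Summable sum
mainTheorem1 𝓛 = record
  { hom-isPCM = hom-isPCM
  ; ∘-zero    = λ g h → trans (∘-congˡ (zeroˡ g)) (zeroʳ h)
  ; ∘-sum     = λ p g h →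
      -- Precomposing first matches the right-nested bracketing `h ∘ (f₀ ∘ g)`.
      postcompose h (precompose p g) ,
      trans (sum-postcompose h (precompose p g)) (∘-congˡ (sum-precompose p g))
  }
  where
  open SummableCategory 𝓛
  open Summability 𝓛
  open module Hom {X Y : Obj} = Setoid (hom X Y) using (trans)
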